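{- Let $k\in\mathbb{Z}_{\ge0}$ and let $\alpha$ be a partition with $\ell(\alpha)\le k$. Then for all partitions $\mu,\nu$, $$C'_{\alpha,\alpha,k}(\mu,\nu)=\begin{cases}1&\text{if }\mu=\emptyset\text{ and }\alpha=\nu,\\0&\text{otherwise.}\end{cases}$$
   Context: Partitions are identified with their Young diagrams (English notation). $\mu'$ is the conjugate (transpose) of $\mu$, $\ell(\mu)$ its number of nonzero rows, and $\emptyset$ the empty partition. The rank $r(\mu)$ is the greatest integer $k\ge 0$ with $\mu_k\ge k$ (side length of the Durfee square; $r(\emptyset)=0$). The $k$-stabilization $\mu_{(k)}$ is the partition obtained from $\mu$ by adding $k$ rows of length $r(\mu)$ (inserted so that the rows remain weakly decreasing). For partitions $\nu\subseteq\alpha$, a tableau of skew shape $\alpha/\nu$ is a filling of the boxes of $\alpha$ not in $\nu$ with positive integers; it is semistandard if rows weakly increase left to right and columns strictly increase top to bottom. Its content is $(c_1,c_2,\dots)$ with $c_i$ the number of labels equal to $i$. Its reverse reading word is obtained by reading the rows right to left, from top to bottom. A word is lattice if for every $i\ge1$ each initial segment contains at least as many $i$'s as $(i+1)$'s. A Littlewood--Richardson tableau is a semistandard tableau whose reverse reading word is lattice. $\mathrm{LR}(\alpha/\nu,\lambda)$ denotes the set of Littlewood--Richardson tableaux of shape $\alpha/\nu$ and content $\lambda$ (empty if $\nu\not\subseteq\alpha$), and $c^{\alpha}_{\nu,\lambda}=|\mathrm{LR}(\alpha/\nu,\lambda)|$. For partitions $\alpha,\beta$ with $|\alpha|=|\beta|$,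 define $C'_{\alpha,\beta,k}(\mu,\nu)=c^{\alpha}_{\nu,\mu_{(k)}}\,c^{\beta}_{\nu,(\mu')_{(k)}}$. -}

module Defs where

open import Data.Nat using (ℕ; zero; suc; _+_; _*_; _≤_; _<_; _≥_; z≤n; s≤s; _≤?_; _<?_; _≟_)
open import Data.Nat.Properties using (≤-refl; ≤-trans; ≤-irrelevant; ≤-decTotalOrder; ≮⇒≥; <⇒≤; <⇒≱; <-≤-trans; n<1+n; allUpTo?)
open import Data.Fin as Fin using (Fin)
open import Data.Fin.Properties using (all?)
open import Data.Product using (_×_; _,_; proj₁; proj₂)
open import Data.List using (List; []; _∷_; length; map; filter; concatMap; take; lookup; replicate; upTo; downFrom; applyUpTo; _++_; cartesianProductWith)
open import Data.Nat.ListAction using (sum)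
open import Data.List.Properties using (take-all; filter-none)
open import Data.List.Extrema.Nat using (max; xs≤max)
import Data.List.Sort.InsertionSort as InsertionSort
open import Data.List.Sort.Base using (SortingAlgorithm)
open import Data.List.Membership.Propositional using (_∈_)
open import Data.List.Membership.Propositional.Properties using (∈-length; ∈-filter⁺; ∈-filter⁻; ∈-upTo⁺; ∈-cartesianProductWith⁺)
open import Data.List.Relation.Unary.All as All using (All; []; _∷_)
import Data.List.Relation.Unary.All.Properties as All
open import Data.List.Relation.Unary.Any using (here; there)
open import Data.List.Relation.Unary.AllPairs using ([]; _∷_)
open import Data.List.Relation.Unary.Linked as Linked using (Linked; []; _∷_)
import Data.List.Relation.Unary.Linked.Properties as Linked
open import Data.List.Relation.Unary.Unique.Propositional using (Unique)
import Data.List.Relation.Unary.Unique.Propositional.Properties as Unique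
open import Data.List.Relation.Binary.Sublist.Propositional using (⊆-refl)
open import Data.List.Relation.Binary.Sublist.Propositional.Properties using (length-mono-≤)
open import Data.List.Relation.Binary.Sublist.Heterogeneous.Properties using (⊆-filter-Sublist)
open import Data.List.Relation.Binary.Permutation.Propositional using (↭-sym)
open import Data.List.Relation.Binary.Permutation.Propositional.Properties using (All-resp-↭)
open import Data.Vec as Vec using (Vec; []; _∷_)
open import Data.Vec.Properties using (∷-injective)
open import Function using (_∘_; _⇔_; mk⇔)
open import Relation.Binary.PropositionalEquality using (_≡_; refl; sym; trans; cong; subst)
import Relation.Binary.Construct.Flip.EqAndOrd as Flip
open import Relation.Nullary using (¬_; Dec; yes; no; does; contradiction)
open import Relation.Nullary.Decidable using (map′; _×-dec_; _→-dec_; ¬?)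
open import Relation.Unary using (Pred; Decidable)
open import Level using (0ℓ)

record Partition : Set where
  constructor mkPartition
  field
    parts      : List ℕ
    decreasing : Linked _≥_ parts
    positive   : All (1 ≤_) parts

open Partition public

parts-injective : ∀ {μ ν} → parts μ ≡ parts ν → μ ≡ ν
parts-injective {mkPartition p d q} {mkPartition .p d′ q′} refl
  with refl ← Linked.irrelevant ≤-irrelevant d d′
     | refl ← All.irrelevant ≤-irrelevant q q′ = refl

∅ : Partition
∅ = mkPartition [] [] []

ℓ : Partition → ℕ
ℓ μ = length (parts μ)

∣_∣ : Partition → ℕ
∣ μ ∣ = sum (parts μ)

-- Rows are numbered from 1; the value at 0 and beyond the last row is 0.
nth : List ℕ → ℕ → ℕ
nth _        zero          = 0
nth []       (suc _)       = 0
nth (x ∷ _)  (suc zero)    = x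
nth (_ ∷ xs) (suc (suc i)) = nth xs (suc i)

part : Partition → ℕ → ℕ
part μ = nth (parts μ)

_⊆_ : Partition → Partition → Set
ν ⊆ α = ∀ i → part ν i ≤ part α i

-- The j-th part of the conjugate is the length of the j-th column, i.e. the
-- number of rows of length at least j, for 1 ≤ j ≤ μ₁.
columnLength : List ℕ → ℕ → ℕ
columnLength xs j = length (filter (j ≤?_) xs)

private
  columnLength-anti : ∀ xs j → columnLength xs (suc j) ≤ columnLength xs j
  columnLength-anti xs j =
    length-mono-≤ (⊆-filter-Sublist (suc j ≤?_) (j ≤?_) (λ { refl → <⇒≤ }) (⊆-refl {x = xs}))

  columnLength-pos : ∀ xs {j} → j < nth xs 1 → 1 ≤ columnLength xs (suc j)
  columnLength-pos (x ∷ xs) {j} j<x = ∈-length (∈-filter⁺ (suc j ≤?_) (here refl) j<x)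

_ᵀ : Partition → Partition
μ ᵀ = mkPartition
  (applyUpTo (columnLength (parts μ) ∘ suc) (part μ 1))
  (Linked.applyUpTo⁺₂ _ (part μ 1) (λ j → columnLength-anti (parts μ) (suc j)))
  (All.applyUpTo⁺₁ _ (part μ 1) (columnLength-pos (parts μ)))

-- The greatest k with μ_k ≥ k.  Only k ≤ ℓ(μ) can qualify, and k = 0 always does.
rank : Partition → ℕ
rank μ = max 0 (filter (λ k → k ≤? part μ k) (upTo (suc (ℓ μ))))

module Descending = InsertionSort (Flip.decTotalOrder ≤-decTotalOrder)

-- The partition with the given rows in some order; rows of length 0 are dropped.
fromRows : List ℕ → Partition
fromRows xs = mkPartition
  (Descending.sort rows)
  (sort-↗ rows)
  (All-resp-↭ (↭-sym (sort-↭ rows)) (All.all-filter (1 ≤?_) xs))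
  where
  open SortingAlgorithm Descending.insertionSort using (sort-↗; sort-↭)
  rows = filter (1 ≤?_) xs

stabilize : ℕ → Partition → Partition
stabilize k μ = fromRows (replicate k (rank μ) ++ parts μ)

-- A box is a pair (row , column), both numbered from 1.
Box : Set
Box = ℕ × ℕ

row col : Box → ℕ
row = proj₁
col = proj₂

_∈ᴰ_ : Box → Partition → Set
(i , j) ∈ᴰ μ = 1 ≤ j × j ≤ part μ i

_∈ᴰ?_ : ∀ b μ → Dec (b ∈ᴰ μ)
(i , j) ∈ᴰ? μ = (1 ≤? j) ×-dec (j ≤? part μ i)

-- Both lists of boxes are in reverse reading order: rows from top to bottom,
-- each row from right to left.
diagram : Partition → List Box
diagram α = concatMap (λ i → map (λ j → i , suc j) (downFrom (part α i)))
                      (applyUpTo suc (ℓ α))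

boxes : Partition → Partition → List Box
boxes α ν = filter (λ b → ¬? (b ∈ᴰ? ν)) (diagram α)

-- A filling is stored as the vector of its labels, position p of the vector
-- holding the label of the p-th box of `boxes α ν`.  Its reverse reading word is
-- therefore the vector itself.
Filling : Partition → Partition → Set
Filling α ν = Vec ℕ (length (boxes α ν))

module _ (α ν : Partition) where

  Position : Set
  Position = Fin (length (boxes α ν))

  box : Position → Box
  box = lookup (boxes α ν)

  label : Filling α ν → Position → ℕ
  label = Vec.lookup

  RowsWeaklyIncrease : Filling α ν → Set
  RowsWeaklyIncrease T = ∀ p q → row (box p) ≡ row (box q) → col (box p) < col (box q) →
                         label T p ≤ label T q

  ColumnsStrictlyIncrease : Filling α ν → Set
  ColumnsStrictlyIncrease T = ∀ p q → col (box p) ≡ col (box q) → row (box p) < row (box q) →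
                              label T p < label T q

  readingWord : Filling α ν → List ℕ
  readingWord = Vec.toList

count : ℕ → List ℕ → ℕ
count i w = length (filter (i ≟_) w)

HasContent : List ℕ → Partition → Set
HasContent w ξ = ∀ i → 1 ≤ i → count i w ≡ part ξ i

Lattice : List ℕ → Set
Lattice w = ∀ i → 1 ≤ i → ∀ m → count (suc i) (take m w) ≤ count i (take m w)

record IsLR (α ν ξ : Partition) (T : Filling α ν) : Set where
  field
    contained      : ν ⊆ α
    labelsPositive : All (1 ≤_) (readingWord α ν T)
    rows           : RowsWeaklyIncrease α ν T
    columns        : ColumnsStrictlyIncrease α ν T
    lattice        : Lattice (readingWord α ν T)
    content        : HasContent (readingWord α ν T) ξ

-- A duplicate-free list of exactly the elements satisfying P; its length is the
-- cardinality of { x | P x }, whichever such list is chosen.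
record Enumeration {A : Set} (P : Pred A 0ℓ) : Set where
  field
    elements : List A
    unique   : Unique elements
    member   : ∀ x → x ∈ elements ⇔ P x

card : {A : Set} {P : Pred A 0ℓ} → Enumeration P → ℕ
card E = length (Enumeration.elements E)

private
  nth-beyond : ∀ xs {i} → length xs < i → nth xs i ≡ 0
  nth-beyond []       {suc i}       _        = refl
  nth-beyond (_ ∷ xs) {suc (suc i)} (s≤s lt) = nth-beyond xs lt

  count-absent : ∀ {i w} → All (_< i) w → count i w ≡ 0
  count-absent a = cong length (filter-none (_ ≟_) (All.map (λ { lt refl → <⇒≱ lt ≤-refl }) a))

  count-present : ∀ {i w} → i ∈ w → 1 ≤ count i w
  count-present {i} i∈w = ∈-length (∈-filter⁺ (i ≟_) i∈w refl)

  above-max : ∀ w {i} → max 0 w < i → All (_< i) w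
  above-max w lt = All.map (λ x≤ → <-≤-trans (s≤s x≤) lt) (xs≤max 0 w)

  decBounded : {P : ℕ → Set} → Decidable P → ∀ N → (∀ n → N ≤ n → P n) → Dec (∀ n → P n)
  decBounded {P} P? N large = map′ to (λ f {n} _ → f n) (allUpTo? P? N)
    where
    to : (∀ {n} → n < N → P n) → ∀ n → P n
    to small n with n <? N
    ... | yes n<N = small n<N
    ... | no  n≮N = large n (≮⇒≥ n≮N)

  contained? : ∀ ν α → Dec (ν ⊆ α)
  contained? ν α = decBounded (λ i → part ν i ≤? part α i) (suc (ℓ ν))
    (λ i lt → subst (_≤ part α i) (sym (nth-beyond (parts ν) lt)) z≤n)

  content? : ∀ w ξ → Dec (HasContent w ξ)
  content? w ξ = decBounded (λ i → (1 ≤? i) →-dec (count i w ≟ part ξ i)) (suc (max 0 w + ℓ ξ))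
    (λ i lt _ → trans (count-absent (above-max w (≤-trans (s≤s (m≤m+n _ _)) lt)))
                      (sym (nth-beyond (parts ξ) (≤-trans (s≤s (m≤n+m _ _)) lt))))
    where open import Data.Nat.Properties using (m≤m+n; m≤n+m)

  lattice? : ∀ w → Dec (Lattice w)
  lattice? w = decBounded (λ i → (1 ≤? i) →-dec prefixes? i) (max 0 w)
    (λ i le _ m → subst (_≤ count i (take m w))
                        (sym (count-absent (All.take⁺ m (above-max w (s≤s le))))) z≤n)
    where
    P : ℕ → List ℕ → Set
    P i u = count (suc i) u ≤ count i u

    prefixes? : ∀ i → Dec (∀ m → P i (take m w))
    prefixes? i = map′ to (λ f {m} _ → f m)
      (allUpTo? (λ m → count (suc i) (take m w) ≤? count i (take m w)) (suc (length w)))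
      where
      to : (∀ {m} → m < suc (length w) → P i (take m w)) → ∀ m → P i (take m w)
      to small m with m <? suc (length w)
      ... | yes lt = small lt
      ... | no ≮   = subst (P i)
        (trans (take-all (length w) w ≤-refl) (sym (take-all m w (<⇒≤ (≮⇒≥ ≮)))))
        (small (n<1+n (length w)))

  rows? : ∀ α ν T → Dec (RowsWeaklyIncrease α ν T)
  rows? α ν T = all? λ p → all? λ q →
    (row (box α ν p) ≟ row (box α ν q)) →-dec (col (box α ν p) <? col (box α ν q))
      →-dec (label α ν T p ≤? label α ν T q)

  columns? : ∀ α ν T → Dec (ColumnsStrictlyIncrease α ν T)
  columns? α ν T = all? λ p → all? λ q →
    (col (box α ν p) ≟ col (box α ν q)) →-dec (row (box α ν p) <? row (box α ν q))
      →-dec (label α ν T p <? label α ν T q)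

  isLR? : ∀ α ν ξ → Decidable (IsLR α ν ξ)
  isLR? α ν ξ T = map′
    (λ (a , b , c , d , e , f) → record
      { contained = a ; labelsPositive = b ; rows = c ; columns = d ; lattice = e ; content = f })
    (λ t → let open IsLR t in contained , labelsPositive , rows , columns , lattice , content)
    (contained? ν α ×-dec All.all? (1 ≤?_) w ×-dec rows? α ν T ×-dec columns? α ν T
      ×-dec lattice? w ×-dec content? w ξ)
    where w = readingWord α ν T

  vectors : List ℕ → ∀ n → List (Vec ℕ n)
  vectors xs zero    = [] ∷ []
  vectors xs (suc n) = cartesianProductWith _∷_ xs (vectors xs n)

  vectors-unique : ∀ {xs} → Unique xs → ∀ n → Unique (vectors xs n)
  vectors-unique u zero    = [] ∷ []
  vectors-unique u (suc n) = Unique.cartesianProductWith⁺ _∷_ ∷-injective u (vectors-unique u n)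

  vectors-complete : ∀ {xs n} (v : Vec ℕ n) → All (_∈ xs) (Vec.toList v) → v ∈ vectors xs n
  vectors-complete []      []       = here refl
  vectors-complete (x ∷ v) (px ∷ a) = ∈-cartesianProductWith⁺ _∷_ px (vectors-complete v a)

  labels-bounded : ∀ w ξ → HasContent w ξ → ∀ {x} → x ∈ w → x < suc (ℓ ξ)
  labels-bounded w ξ h {zero}  _ = s≤s z≤n
  labels-bounded w ξ h {suc x} x∈w with suc x <? suc (ℓ ξ)
  ... | yes lt = lt
  ... | no ≮   = contradiction
    (subst (1 ≤_) (trans (h (suc x) (s≤s z≤n)) (nth-beyond (parts ξ) (≮⇒≥ ≮))) (count-present {w = w} x∈w))
    λ ()

  filterEnumeration : {A : Set} {P : Pred A 0ℓ} → Decidable P → (xs : List A) → Unique xs →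
                      (∀ x → P x → x ∈ xs) → Enumeration P
  filterEnumeration P? xs u complete = record
    { elements = filter P? xs
    ; unique   = Unique.filter⁺ P? u
    ; member   = λ x → mk⇔ (λ x∈ → proj₂ (∈-filter⁻ P? {xs = xs} x∈))
                           (λ px → ∈-filter⁺ P? (complete x px) px)
    }

  candidates : ∀ α ν → Partition → List (Filling α ν)
  candidates α ν ξ = vectors (upTo (suc (ℓ ξ))) (length (boxes α ν))

  candidates-complete : ∀ α ν ξ T → IsLR α ν ξ T → T ∈ candidates α ν ξ
  candidates-complete α ν ξ T t = vectors-complete {xs = upTo (suc (ℓ ξ))} T
    (All.tabulate λ {x} x∈w →
      ∈-upTo⁺ (labels-bounded (readingWord α ν T) ξ (IsLR.content t) {x} x∈w))

-- LR(α/ν, ξ), where ξ is the content.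
LR : ∀ α ν ξ → Enumeration (IsLR α ν ξ)
LR α ν ξ = filterEnumeration (isLR? α ν ξ) (candidates α ν ξ)
  (vectors-unique (Unique.upTo⁺ (suc (ℓ ξ))) (length (boxes α ν))) (candidates-complete α ν ξ)

-- c α ν ξ is c^α_{ν,ξ}.
c : (α ν ξ : Partition) → ℕ
c α ν ξ = card (LR α ν ξ)

C′ : (α β : Partition) → .(∣ α ∣ ≡ ∣ β ∣) → ℕ → (μ ν : Partition) → ℕ
C′ α β _ k μ ν = c α ν (stabilize k μ) * c β ν (stabilize k (μ ᵀ))

{-# OPTIONS --safe #-}

-- By the lattice condition, each label i+1 of a Littlewood–Richardson tableau is
-- preceded in the reading word by a label i, and this lies in a strictly higher
-- row.  So a label in row r is at most r, and the content has at most ℓ(α) parts.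
-- If μ is nonempty its rank is positive, so μ₍ₖ₎ has k + ℓ(μ) > k ≥ ℓ(α) parts and
-- the first factor already vanishes.  If μ = ∅ then μ₍ₖ₎ = ∅, and a tableau with
-- empty content exists exactly when α = ν.
module Submission where

open import Defs
open import Data.Nat using (ℕ; _≤_)
open import Data.Product using (_×_)
open import Relation.Nullary using (¬_)
open import Relation.Binary.PropositionalEquality using (_≡_; refl)

open import Data.Nat using (zero; suc; _+_; _*_; _<_; z≤n; s≤s; _≤?_; _≟_)
open import Data.Nat.Properties using (≤-refl; ≤-trans; ≤-antisym; ≤-reflexive; <⇒≱; ≤∧≢⇒<; ≮⇒≥; n≮n; m<m+n)
open import Data.Fin as Fin using (Fin; toℕ)
open import Data.Fin.Properties using (toℕ-injective; ¬Fin0)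
open import Data.Product using (∃; _,_; proj₁; proj₂)
open import Data.Sum using (_⊎_; inj₁; inj₂)
open import Data.List using (List; []; _∷_; length; map; filter; take; lookup; replicate; downFrom; applyUpTo; _++_)
open import Data.List.Properties using (take-all; filter-all; filter-none; length-++; length-replicate)
open import Data.List.Extrema.Nat using (v≤max⁺)
open import Data.List.Sort.Base using (SortingAlgorithm)
open import Data.List.Membership.Propositional using (_∈_; lose; find)
open import Data.List.Membership.Propositional.Properties using (∈-length; ∈-filter⁺; ∈-filter⁻; ∈-upTo⁺; ∈-map⁺; ∈-map⁻; ∈-concatMap⁺; ∈-concatMap⁻; ∈-applyUpTo⁺; ∈-downFrom⁺; ∈-downFrom⁻; ∈-lookup)
open import Data.List.Relation.Unary.Any using (here; there)
open import Data.List.Relation.Unary.All as All using (All; []; _∷_)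
import Data.List.Relation.Unary.All.Properties as All
open import Data.List.Relation.Unary.AllPairs using (AllPairs; _∷_)
import Data.List.Relation.Unary.AllPairs.Properties as AllPairs
open import Data.List.Relation.Binary.Permutation.Propositional.Properties using (↭-length)
open import Data.Vec as Vec using (Vec; []; _∷_)
open import Data.Vec.Properties using (length-toList)
open import Function using (id; Equivalence)
open import Relation.Binary.PropositionalEquality using (_≢_; sym; trans; cong; cong₂; subst; module ≡-Reasoning)
open import Relation.Nullary using (contradiction)
open import Relation.Nullary.Decidable using (¬?)
open import Relation.Unary using (Pred)
open import Level using (0ℓ)

module _ {A : Set} where

  AllPairs-lookup : {R : A → A → Set} {xs : List A} → AllPairs R xs →
                    ∀ {p q} → p Fin.< q → R (lookup xs p) (lookup xs q)
  AllPairs-lookup {xs = _ ∷ xs} (rs ∷ _) {Fin.zero}  {Fin.suc q} _         = All.lookup rs (∈-lookup {xs = xs} q)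
  AllPairs-lookup               (_ ∷ ap) {Fin.suc p} {Fin.suc q} (s≤s p<q) = AllPairs-lookup ap p<q

  ∈-take⁻ : ∀ {n x} m (v : Vec A n) → x ∈ take m (Vec.toList v) →
            ∃ λ q → toℕ q < m × Vec.lookup v q ≡ x
  ∈-take⁻ (suc m) (_ ∷ v) (here refl) = Fin.zero , s≤s z≤n , refl
  ∈-take⁻ (suc m) (_ ∷ v) (there x∈) with q , q<m , eq ← ∈-take⁻ m v x∈ = Fin.suc q , s≤s q<m , eq

  ∈-take⁺ : ∀ {n} (v : Vec A n) p → Vec.lookup v p ∈ take (suc (toℕ p)) (Vec.toList v)
  ∈-take⁺ (_ ∷ _) Fin.zero    = here refl
  ∈-take⁺ (_ ∷ v) (Fin.suc p) = there (∈-take⁺ v p)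

  ∈-toList⁻ : ∀ {n x} (v : Vec A n) → x ∈ Vec.toList v → ∃ λ q → Vec.lookup v q ≡ x
  ∈-toList⁻ {n} v x∈
    with q , _ , eq ← ∈-take⁻ n v (subst (_ ∈_) (sym (take-all n _ (≤-reflexive (length-toList v)))) x∈) = q , eq

  card≡0 : {P : Pred A 0ℓ} (E : Enumeration P) → (∀ x → ¬ P x) → card E ≡ 0
  card≡0 E ¬P with Enumeration.elements E | Enumeration.member E
  ... | []    | _      = refl
  ... | x ∷ _ | member = contradiction (Equivalence.to (member x) (here refl)) (¬P x)

  -- Any two elements of `A` itself are required to be equal. This suits fillings of an empty shape,
  -- which are vectors of length 0.
  card≡1 : {P : Pred A 0ℓ} (E : Enumeration P) → ∃ P → (∀ x y → x ≡ y) → card E ≡ 1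
  card≡1 E (x , Px) irr with Enumeration.elements E | Enumeration.unique E | Enumeration.member E
  ... | []        | _                | member with () ← Equivalence.from (member x) Px
  ... | _ ∷ []    | _                | _ = refl
  ... | y ∷ z ∷ _ | (y≢z ∷ _) ∷ _ | _ = contradiction (irr y z) y≢z

count-positive⇒∈ : ∀ {i} w → 1 ≤ count i w → i ∈ w
count-positive⇒∈ {i} w pos = go refl pos
  where
  go : ∀ {ys} → filter (i ≟_) w ≡ ys → 1 ≤ length ys → i ∈ w
  go {y ∷ _} eq _ with y∈w , refl ← ∈-filter⁻ (i ≟_) {xs = w} (subst (y ∈_) (sym eq) (here refl)) = y∈w

∈⇒count-positive : ∀ {i w} → i ∈ w → 1 ≤ count i w
∈⇒count-positive {i} i∈w = ∈-length (∈-filter⁺ (i ≟_) i∈w refl)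

nth-bounds : ∀ xs i → 1 ≤ nth xs i → 1 ≤ i × i ≤ length xs
nth-bounds (x ∷ xs) (suc zero)    _   = s≤s z≤n , s≤s z≤n
nth-bounds (x ∷ xs) (suc (suc i)) pos = s≤s z≤n , s≤s (proj₂ (nth-bounds xs (suc i) pos))

nth-positive : ∀ {xs} → All (1 ≤_) xs → ∀ {i} → 1 ≤ i → i ≤ length xs → 1 ≤ nth xs i
nth-positive (px ∷ _) {suc zero}    _ _         = px
nth-positive (_ ∷ ps) {suc (suc i)} _ (s≤s i≤n) = nth-positive ps (s≤s z≤n) i≤n

-- Positivity makes the lengths agree: `nth` is 0 beyond the end, so it cannot see trailing zeros.
nth-injective : ∀ {xs ys} → All (1 ≤_) xs → All (1 ≤_) ys → (∀ i → nth xs i ≡ nth ys i) → xs ≡ ys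
nth-injective []       []       _  = refl
nth-injective []       (q ∷ _)  eq = contradiction (subst (1 ≤_) (sym (eq 1)) q) λ ()
nth-injective (p ∷ _)  []       eq = contradiction (subst (1 ≤_) (eq 1) p) λ ()
nth-injective (_ ∷ ps) (_ ∷ qs) eq = cong₂ _∷_ (eq 1) (nth-injective ps qs tails)
  where
  tails : ∀ i → nth _ i ≡ nth _ i
  tails zero    = refl
  tails (suc i) = eq (suc (suc i))

⊆-antisym : ∀ {α ν} → α ⊆ ν → ν ⊆ α → α ≡ ν
⊆-antisym {α} {ν} α⊆ν ν⊆α = parts-injective
  (nth-injective (positive α) (positive ν) λ i → ≤-antisym (α⊆ν i) (ν⊆α i))

∈ᴰ⇒row-bounds : ∀ α b → b ∈ᴰ α → 1 ≤ row b × row b ≤ ℓ α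
∈ᴰ⇒row-bounds α (i , _) (1≤j , j≤) = nth-bounds (parts α) i (≤-trans 1≤j j≤)

∈-diagram⁻ : ∀ α {b} → b ∈ diagram α → b ∈ᴰ α
∈-diagram⁻ α b∈
  with i , _ , b∈row ← find (∈-concatMap⁻ (λ i → map (λ j → i , suc j) (downFrom (part α i))) {xs = applyUpTo suc (ℓ α)} b∈)
  with j , j∈ , refl ← ∈-map⁻ (λ j → i , suc j) b∈row
  = s≤s z≤n , ∈-downFrom⁻ j∈

∈-diagram⁺ : ∀ α b → b ∈ᴰ α → b ∈ diagram α
∈-diagram⁺ α (suc i , suc j) b∈ᴰ@(_ , j≤) = ∈-concatMap⁺ _ (lose
  (∈-applyUpTo⁺ suc (proj₂ (∈ᴰ⇒row-bounds α _ b∈ᴰ)))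
  (∈-map⁺ (λ j → suc i , suc j) (∈-downFrom⁺ j≤)))
∈-diagram⁺ α (zero , j) b∈ᴰ = contradiction (proj₁ (∈ᴰ⇒row-bounds α (zero , j) b∈ᴰ)) λ ()

-- The reverse reading order; it turns a comparison of positions in the word into one of boxes.
_≺_ : Box → Box → Set
b ≺ b′ = row b < row b′ ⊎ (row b ≡ row b′ × col b′ < col b)

diagram-sorted : ∀ α → AllPairs _≺_ (diagram α)
diagram-sorted α = AllPairs.concat⁺
  -- The first argument of `concat⁺` compares boxes of one row, where `downFrom` makes columns
  -- decrease; the second compares boxes of different rows.
  (All.map⁺ (All.universal (λ i → AllPairs.map⁺ (AllPairs.applyDownFrom⁺₁ id _ λ j<i _ → inj₂ (refl , s≤s j<i))) _))
  (AllPairs.map⁺ (AllPairs.applyUpTo⁺₁ suc (ℓ α) λ i<i′ _ →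
    All.map⁺ (All.universal (λ _ → All.map⁺ (All.universal (λ _ → inj₁ (s≤s i<i′)) _)) _)))

boxes-sorted : ∀ α ν → AllPairs _≺_ (boxes α ν)
boxes-sorted α ν = AllPairs.filter⁺ (λ b → ¬? (b ∈ᴰ? ν)) (diagram-sorted α)

box-row-bounds : ∀ α ν p → 1 ≤ row (box α ν p) × row (box α ν p) ≤ ℓ α
box-row-bounds α ν p = ∈ᴰ⇒row-bounds α (box α ν p) (∈-diagram⁻ α (proj₁ (∈-filter⁻ (λ b → ¬? (b ∈ᴰ? ν))
  {xs = diagram α} (∈-lookup {xs = boxes α ν} p))))

boxes-self : ∀ α → boxes α α ≡ []
boxes-self α = filter-none (λ b → ¬? (b ∈ᴰ? α)) (All.tabulate λ b∈ b∉ → b∉ (∈-diagram⁻ α b∈))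

-- If row `i` of `α` were longer than row `i` of `ν`, its last box would lie outside `ν`.
boxes-empty⇒⊆ : ∀ α ν → boxes α ν ≡ [] → α ⊆ ν
boxes-empty⇒⊆ α ν eq i = ≮⇒≥ λ ν<α →
  let 1≤α = ≤-trans (s≤s z≤n) ν<α
      b∈  = ∈-filter⁺ (λ b → ¬? (b ∈ᴰ? ν)) (∈-diagram⁺ α (i , part α i) (1≤α , ≤-refl)) (λ b∈ν → <⇒≱ ν<α (proj₂ b∈ν))
  in contradiction (subst ((i , part α i) ∈_) eq b∈) λ ()

module _ {α ν ξ : Partition} {T : Filling α ν} (t : IsLR α ν ξ T) where
  open IsLR t

  private
    lab : Position α ν → ℕ
    lab = label α ν T

  -- The prefix of length `suc (toℕ p)` ends at `p` and contains `suc i`, so the lattice condition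
  -- puts an `i` in it. That `i` is not at `p`, whose label is `suc i`.
  predecessor-earlier : ∀ {i} p → 1 ≤ i → lab p ≡ suc i → ∃ λ q → q Fin.< p × lab q ≡ i
  predecessor-earlier {i} p 1≤i eq
    with q , s≤s q≤p , refl ← ∈-take⁻ (suc (toℕ p)) T (count-positive⇒∈ _
           (≤-trans (∈⇒count-positive (subst (_∈ take (suc (toℕ p)) (Vec.toList T)) eq (∈-take⁺ T p)))
                    (lattice i 1≤i (suc (toℕ p)))))
    = q , ≤∧≢⇒< q≤p q≢p , refl
    where
    q≢p : toℕ q ≢ toℕ p
    q≢p q≡p with refl ← toℕ-injective q≡p = n≮n _ (≤-reflexive (sym eq))

  -- The i preceding an i+1 in the reading word cannot lie in the same row, where
  -- it would be a smaller label further to the right.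
  predecessor-above : ∀ {i} p → 1 ≤ i → lab p ≡ suc i →
                      ∃ λ q → row (box α ν q) < row (box α ν p) × lab q ≡ i
  predecessor-above {i} p 1≤i eq
    with q , q<p , eq′ ← predecessor-earlier p 1≤i eq
    with AllPairs-lookup (boxes-sorted α ν) q<p
  ... | inj₁ row<          = q , row< , eq′
  ... | inj₂ (row≡ , col<) =
    contradiction (subst (_≤ i) eq (subst (lab p ≤_) eq′ (rows p q (sym row≡) col<))) (n≮n _)

  -- Structural induction on the label, which is why `i` is separate from `p`: each step moves to
  -- another position. The base case is that rows are numbered from 1.
  label≤row : ∀ i p → lab p ≡ i → i ≤ row (box α ν p)
  label≤row zero          p _  = z≤n
  label≤row (suc zero)    p _  = proj₁ (box-row-bounds α ν p)
  label≤row (suc (suc i)) p eq =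
    let q , row< , eq′ = predecessor-above p (s≤s z≤n) eq
    in ≤-trans (s≤s (label≤row (suc i) q eq′)) row<

  content-length≤ : ℓ ξ ≤ ℓ α
  -- With more than `ℓ α` parts in `ξ`, the label `suc (ℓ α)` would occur, in a row beyond the last
  -- one of `α`.
  content-length≤ = ≮⇒≥ λ α<ξ →
    let q , eq = ∈-toList⁻ T (count-positive⇒∈ {suc (ℓ α)} (Vec.toList T) (subst (1 ≤_) (sym (content _ (s≤s z≤n)))
                   (nth-positive (positive ξ) (s≤s z≤n) α<ξ)))
    in <⇒≱ (label≤row (suc (ℓ α)) q eq) (proj₂ (box-row-bounds α ν q))

-- A box would carry a positive label, which empty content counts 0 times. Hence `boxes α ν` is
-- empty and `α ⊆ ν`.
empty-content⇒≡ : ∀ {α ν T} → IsLR α ν ∅ T → α ≡ ν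
empty-content⇒≡ {α} {ν} {T} t = ⊆-antisym (boxes-empty⇒⊆ α ν (go T labelsPositive content)) contained
  where
  open IsLR t
  nil : ∀ i → nth [] i ≡ 0
  nil zero    = refl
  nil (suc _) = refl
  -- Generalised from `boxes α ν` to any list, so that it can be matched on.
  go : ∀ {bs : List Box} (v : Vec ℕ (length bs)) → All (1 ≤_) (Vec.toList v) → HasContent (Vec.toList v) ∅ → bs ≡ []
  go {[]}    _       _         _ = refl
  go {_ ∷ _} (x ∷ v) (1≤x ∷ _) h =
    contradiction (subst (1 ≤_) (trans (h x 1≤x) (nil x)) (∈⇒count-positive {w = x ∷ Vec.toList v} (here refl))) λ ()

c-self-∅ : ∀ α → c α α ∅ ≡ 1
c-self-∅ α = card≡1 (LR α α ∅) (inhabited (boxes-self α)) (λ T T′ → irrelevant (cong length (boxes-self α)) T T′)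
  where
  -- `boxes α α` is only propositionally `[]`, so the length becomes a variable whose equation can
  -- be matched.
  irrelevant : ∀ {n} → n ≡ 0 → (v w : Vec ℕ n) → v ≡ w
  irrelevant refl [] [] = refl
  noPosition : boxes α α ≡ [] → ¬ Position α α
  noPosition eq p = ¬Fin0 (subst (λ bs → Fin (length bs)) eq p)
  word : ∀ {n} → n ≡ 0 → ∃ λ (v : Vec ℕ n) → Vec.toList v ≡ []
  word refl = [] , refl
  count-[] : ∀ i → 1 ≤ i → 0 ≡ nth [] i
  count-[] (suc _) _ = refl
  inhabited : boxes α α ≡ [] → ∃ (IsLR α α ∅)
  inhabited eq with T , w≡ ← word (cong length eq) = T , record
    { contained      = λ _ → ≤-refl
    ; labelsPositive = subst (All _) (sym w≡) []
    ; rows           = λ p → contradiction p (noPosition eq)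
    ; columns        = λ p → contradiction p (noPosition eq)
    ; lattice        = subst Lattice (sym w≡) λ { i _ zero → z≤n ; i _ (suc _) → z≤n }
    ; content        = λ i 1≤i → trans (cong (count i) w≡) (count-[] i 1≤i)
    }

open SortingAlgorithm Descending.insertionSort using (sort-↭)

-- The rank of `∅` is 0, and `fromRows` drops the `k` added rows of length 0.
stabilize-∅ : ∀ k → stabilize k ∅ ≡ ∅
stabilize-∅ k = parts-injective (cong Descending.sort (filter-none (1 ≤?_) (All.++⁺ (All.replicate⁺ k λ ()) [])))

rank-positive : ∀ μ → 1 ≤ ℓ μ → 1 ≤ rank μ
-- The index 1 qualifies, since the first row is nonempty.
rank-positive μ 1≤ℓ = v≤max⁺ 0 _ (inj₂ (lose
  (∈-filter⁺ (λ k → k ≤? part μ k) (∈-upTo⁺ (s≤s 1≤ℓ)) (nth-positive (positive μ) ≤-refl 1≤ℓ)) ≤-refl))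

-- Positive rank keeps all `k` added rows through the filter, and sorting preserves length.
length-stabilize : ∀ k μ → 1 ≤ ℓ μ → k < ℓ (stabilize k μ)
length-stabilize k μ 1≤ℓ = subst (k <_) (sym length≡) (m<m+n k 1≤ℓ)
  where
  open ≡-Reasoning
  newRows = replicate k (rank μ)
  allRows = newRows ++ parts μ

  length≡ : ℓ (stabilize k μ) ≡ k + ℓ μ
  length≡ = begin
    ℓ (stabilize k μ)                ≡⟨ ↭-length (sort-↭ (filter (1 ≤?_) allRows)) ⟩
    length (filter (1 ≤?_) allRows)  ≡⟨ cong length (filter-all (1 ≤?_) (All.++⁺ (All.replicate⁺ k (rank-positive μ 1≤ℓ)) (positive μ))) ⟩
    length allRows                   ≡⟨ length-++ newRows ⟩
    length newRows + ℓ μ             ≡⟨ cong (_+ ℓ μ) (length-replicate k) ⟩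
    k + ℓ μ                          ∎

LR-stabilize⇒ : ∀ {k α μ ν T} → ℓ α ≤ k → IsLR α ν (stabilize k μ) T → μ ≡ ∅ × α ≡ ν
-- `μ` may differ from `∅` in its proof fields, hence `parts-injective`; `stabilize` sees only the
-- parts.
LR-stabilize⇒ {k} {μ = mkPartition [] _ _} _ t = parts-injective refl , empty-content⇒≡ (subst (λ ξ → IsLR _ _ ξ _) (stabilize-∅ k) t)
LR-stabilize⇒ {k} {μ = μ@(mkPartition (_ ∷ _) _ _)} ℓ≤k t =
  contradiction (≤-trans (content-length≤ t) ℓ≤k) (<⇒≱ (length-stabilize k μ (s≤s z≤n)))

proposition5p4 : (k : ℕ) (α : Partition) → ℓ α ≤ k → (μ ν : Partition) →
    ((μ ≡ ∅ × α ≡ ν) → C′ α α refl k μ ν ≡ 1) ×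
    (¬ (μ ≡ ∅ × α ≡ ν) → C′ α α refl k μ ν ≡ 0)
proposition5p4 k α ℓ≤k μ ν = one , vanishes
  where
  one : μ ≡ ∅ × α ≡ ν → C′ α α refl k μ ν ≡ 1
  -- The parts of `∅ ᵀ` compute to `[]`, so `c≡1` serves for both factors.
  one (refl , refl) = cong₂ _*_ c≡1 c≡1
    where
    c≡1 : c α α (stabilize k ∅) ≡ 1
    c≡1 = trans (cong (c α α) (stabilize-∅ k)) (c-self-∅ α)
  vanishes : ¬ (μ ≡ ∅ × α ≡ ν) → C′ α α refl k μ ν ≡ 0
  vanishes ¬eq = cong (_* c α ν (stabilize k (μ ᵀ)))
    (card≡0 (LR α ν (stabilize k μ)) λ T t → ¬eq (LR-stabilize⇒ ℓ≤k t))
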